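{- The polynomial $T_{\mathsf{M}}(x+1,x+1)$ does not have log-concave coefficients in general, and moreover is not unimodal in general. That is, there exists a matroid $\mathsf{M}$ such that the sequence of coefficients of the univariate polynomial $T_{\mathsf{M}}(x+1,x+1)$ is not log-concave, and there exists a matroid $\mathsf{M}$ such that this sequence is not unimodal.
   Context: For a matroid $\mathsf{M}$ on $E$ with rank function $\operatorname{rk}$, the Tutte polynomial is $T_{\mathsf{M}}(x,y)=\sum_{A\subseteq E}(x-1)^{\operatorname{rk}(E)-\operatorname{rk}(A)}(y-1)^{|A|-\operatorname{rk}(A)}$. A finite real sequence $(a_0,\dots,a_d)$ is unimodal if $a_0\le\dots\le a_m\ge\dots\ge a_d$ for some $m$, and log-concave if $a_i^2\ge a_{i-1}a_{i+1}$ for all $0<i<d$. -}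

module Defs where

open import Algebra.Bundles.Raw using (RawRing)
import Algebra.Definitions.RawSemiring as RawSemiringDefs
open import Data.Bool.Base using (true; false)
open import Data.Fin.Subset using (Subset; _⊆_; _∪_; _∩_; ∣_∣; ⊤)
open import Data.Integer.Base as ℤ using (ℤ)
open import Data.List.Base using (List; []; _∷_; [_]; map; _++_; foldr)
open import Data.Nat.Base using (ℕ; zero; suc; _+_; _∸_; _≤_; _<_)
open import Data.Product.Base using (∃-syntax; _×_)
import Data.Vec.Base as Vec
open import Level using (0ℓ)
open import Relation.Nullary using (¬_)

-- Matroids on the ground set Fin n, axiomatised by their rank function.
record Matroid (n : ℕ) : Set where
  field
    rk          : Subset n → ℕ
    rk-bounded  : ∀ A → rk A ≤ ∣ A ∣
    rk-monotone : ∀ {A B} → A ⊆ B → rk A ≤ rk B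
    rk-submod   : ∀ A B → rk (A ∪ B) + rk (A ∩ B) ≤ rk A + rk B

-- R[t]: the list a₀ ∷ a₁ ∷ … ∷ [] stands for a₀ + a₁ t + ….  Trailing zeros
-- are permitted, so equality of polynomials is equality of all coefficients.
module Polynomial {c ℓ} (R : RawRing c ℓ) where
  private module R = RawRing R

  Poly : Set c
  Poly = List R.Carrier

  coeff : Poly → ℕ → R.Carrier
  coeff []      _       = R.0#
  coeff (a ∷ p) zero    = a
  coeff (a ∷ p) (suc i) = coeff p i

  _≈ₚ_ : Poly → Poly → Set ℓ
  p ≈ₚ q = ∀ i → coeff p i R.≈ coeff q i

  constant : R.Carrier → Poly
  constant a = [ a ]

  variable-t : Poly
  variable-t = R.0# ∷ R.1# ∷ []

  _+ₚ_ : Poly → Poly → Poly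
  []      +ₚ q       = q
  (a ∷ p) +ₚ []      = a ∷ p
  (a ∷ p) +ₚ (b ∷ q) = (a R.+ b) ∷ (p +ₚ q)

  _*ₚ_ : Poly → Poly → Poly
  []      *ₚ q = []
  (a ∷ p) *ₚ q = map (a R.*_) q +ₚ (R.0# ∷ (p *ₚ q))

  HasDegree : Poly → ℕ → Set ℓ
  HasDegree p d =
    ¬ (coeff p d R.≈ R.0#) × (∀ i → d < i → coeff p i R.≈ R.0#)

  ring : RawRing c ℓ
  ring = record
    { Carrier = Poly
    ; _≈_     = _≈ₚ_
    ; _+_     = _+ₚ_
    ; _*_     = _*ₚ_
    ; -_      = map (R.-_)
    ; 0#      = []
    ; 1#      = constant R.1#
    }

-- The value at t = s of a polynomial over R, its coefficients being sent to S
-- along φ.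
evaluate : ∀ {c ℓ c′ ℓ′} (R : RawRing c ℓ) (S : RawRing c′ ℓ′) →
           (RawRing.Carrier R → RawRing.Carrier S) → RawRing.Carrier S →
           Polynomial.Poly R → RawRing.Carrier S
evaluate R S φ s = foldr (λ a v → φ a S.+ s S.* v) S.0#
  where module S = RawRing S

ℤ-ring ℤ[x] ℤ[x,y] : RawRing 0ℓ 0ℓ
ℤ-ring = ℤ.+-*-rawRing
ℤ[x]   = Polynomial.ring ℤ-ring
ℤ[x,y] = Polynomial.ring ℤ[x]

subsets : ∀ n → List (Subset n)
subsets zero    = [ Vec.[] ]
subsets (suc n) = map (false Vec.∷_) (subsets n) ++ map (true Vec.∷_) (subsets n)

private
  module P = RawRing ℤ[x,y]
  module Q = RawRing ℤ[x]

x y : P.Carrier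
x = Polynomial.constant ℤ[x] (Polynomial.variable-t ℤ-ring)
y = Polynomial.variable-t ℤ[x]

module _ {n} (M : Matroid n) where
  open Matroid M
  open RawSemiringDefs P.rawSemiring using (_^_)

  -- Both truncated subtractions are exact, by rk-monotone and rk-bounded.
  tutteTerm : Subset n → P.Carrier
  tutteTerm A = ((x P.+ (P.- P.1#)) ^ (rk ⊤ ∸ rk A))
                P.* ((y P.+ (P.- P.1#)) ^ (∣ A ∣ ∸ rk A))

  tutte : P.Carrier
  tutte = foldr (λ A s → tutteTerm A P.+ s) P.0# (subsets n)

-- f(p , q) for f ∈ ℤ[x,y] and p , q ∈ ℤ[x].
substitute : P.Carrier → (p q : Q.Carrier) → Q.Carrier
substitute f p q =
  evaluate ℤ[x] ℤ[x] (evaluate ℤ-ring ℤ[x] (Polynomial.constant ℤ-ring) p) q f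

x+1 : Q.Carrier
x+1 = Polynomial.variable-t ℤ-ring Q.+ Q.1#

-- T_M(x + 1 , x + 1) ∈ ℤ[x].
diagonalTutte : ∀ {n} → Matroid n → Q.Carrier
diagonalTutte M = substitute (tutte M) x+1 x+1

-- The finite sequence (a₀ , … , a_d) is given by d and a : ℕ → ℤ; the
-- predicates below only inspect the values of a at indices at most d.

Unimodal : ℕ → (ℕ → ℤ) → Set
Unimodal d a = ∃[ m ] m ≤ d
  × (∀ i → i < m → a i ℤ.≤ a (suc i))
  × (∀ i → m ≤ i → i < d → a (suc i) ℤ.≤ a i)

-- The middle index of the inequality is suc i.
LogConcave : ℕ → (ℕ → ℤ) → Set
LogConcave d a = ∀ i → suc i < d →
  a i ℤ.* a (suc (suc i)) ℤ.≤ a (suc i) ℤ.* a (suc i)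

-- The coefficient of xⁱ in T_M(x+1,x+1) is the number of sets A with
-- (rk E − rk A) + (|A| − rk A) = i.  For the uniform matroid of rank r on n
-- elements this exponent is ||A| − r|, so the coefficients (i > 0) are
-- U i = C(n,r−i) + C(n,r+i).  Turning r-sets that pairwise share at most r − 2
-- elements into circuit-hyperplanes moves each of them from exponent 0 to
-- exponent 2, and nothing else changes.  For r near n/2 − √n/2 the numbers U i
-- are almost constant for small i, and for n = 176, r = 81 they satisfy
-- U 3 < U 4 and U 3 − U 2 < C(n,r)/n.  By the pigeonhole principle Graham and
-- Sloane's code {A : |A| = r, Σ A ≡ c mod n} provides, for some c, more than
-- U 3 − U 2 circuit-hyperplanes, and then the coefficient of x³ is smaller than
-- both of its neighbours.

{-# OPTIONS --safe #-}

module Submission where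

open import Defs
open import Algebra.Bundles using (CommutativeSemiring)
open import Algebra.Bundles.Raw using (RawRing)
import Algebra.Definitions.RawSemiring as RawSemiringDefs
import Algebra.Properties.CommutativeSemigroup as CommutativeSemigroupProperties
open import Algebra.Structures using (IsCommutativeSemiring)
import Algebra.Structures.Biased as Biased
open import Data.Bool.Base using (Bool; true; false; if_then_else_; _∧_)
import Data.Bool.Properties as Bool
open import Data.Fin.Subset
  using (Subset; inside; outside; _∈_; _⊆_; _∪_; _∩_; ∣_∣; ⊤)
open import Data.Fin.Subset.Properties
  using (_⊆?_; ⊆-antisym; ⊆-reflexive; ∣p∣≤n; ∣⊤∣≡n; p⊆q⇒∣p∣≤∣q∣; p∩q⊆p;
         p⊆p∪q; x∈p∩q⁺; x∈p∪q⁻; ∩-comm; ∪-comm; ∣p∩q∣≤∣p∣; ∣p∩q∣≤∣q∣)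
open import Data.Integer.Base as ℤ using (ℤ)
import Data.Integer.Properties as ℤ
open import Data.List.Base using ([]; _∷_; map; foldr; _++_)
open import Data.List.Properties using (map-++; map-∘)
open import Data.Nat.Base using (ℕ; zero; suc)
open import Data.Product.Base
  using (Σ-syntax; ∃-syntax; ∃₂; _×_; _,_; proj₁; proj₂)
open import Data.Sum.Base using (inj₁; inj₂; [_,_]′)
open import Data.Vec.Base using ([]; _∷_; here; there)
import Data.Vec.Properties as Vec
open import Function.Base using (_∘_; id)
open import Relation.Binary.Bundles using (Setoid)
open import Relation.Binary.Core using (Rel)
open import Relation.Binary.PropositionalEquality
import Relation.Binary.Reasoning.Setoid as SetoidReasoning
open import Relation.Nullary using (¬_; Dec; yes; no; does; contradiction)
open import Relation.Nullary.Decidable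
  using (dec-true; dec-false; decidable-stable; _×-dec_)
open import Relation.Unary using (Decidable)

-- Polynomials over a commutative semiring

module PolynomialProperties {c ℓ} (R : RawRing c ℓ)
  (isCommutativeSemiring : IsCommutativeSemiring (RawRing._≈_ R)
    (RawRing._+_ R) (RawRing._*_ R) (RawRing.0# R) (RawRing.1# R)) where

  open RawRing R
  open Polynomial R
  private
    R-semiring : CommutativeSemiring c ℓ
    R-semiring = record { isCommutativeSemiring = isCommutativeSemiring }
    module R = CommutativeSemiring R-semiring

  infixr 7 _·_
  _·_ : Carrier → Poly → Poly
  a · p = map (a *_) p

  shift : Poly → Poly
  shift p = 0# ∷ p

  coeff-+ : ∀ p q i → coeff (p +ₚ q) i ≈ coeff p i + coeff q i
  coeff-+ []      q       i       = R.sym (R.+-identityˡ _)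
  coeff-+ (a ∷ p) []      i       = R.sym (R.+-identityʳ _)
  coeff-+ (a ∷ p) (b ∷ q) zero    = R.refl
  coeff-+ (a ∷ p) (b ∷ q) (suc i) = coeff-+ p q i

  coeff-· : ∀ a p i → coeff (a · p) i ≈ a * coeff p i
  coeff-· a []      i       = R.sym (R.zeroʳ a)
  coeff-· a (b ∷ p) zero    = R.refl
  coeff-· a (b ∷ p) (suc i) = coeff-· a p i

  -- Unlike _≈ₚ_, which unfolds to a function type, this record lets
  -- unification recover the two polynomials.
  infix 4 _≋_
  record _≋_ (p q : Poly) : Set ℓ where
    constructor pointwise
    field coeffs : p ≈ₚ q
  open _≋_ public

  ≋-setoid : Setoid c ℓ
  ≋-setoid = record
    { Carrier       = Poly
    ; _≈_           = _≋_
    ; isEquivalence = record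
      { refl  = pointwise λ i → R.refl
      ; sym   = λ p≋q → pointwise λ i → R.sym (coeffs p≋q i)
      ; trans = λ p≋q q≋r → pointwise λ i → R.trans (coeffs p≋q i) (coeffs q≋r i)
      }
    }

  private module P = Setoid ≋-setoid

  module _ where
    open SetoidReasoning R.setoid

    +ₚ-cong : ∀ {p p′ q q′} → p ≋ p′ → q ≋ q′ → (p +ₚ q) ≋ (p′ +ₚ q′)
    +ₚ-cong {p} {p′} {q} {q′} p≈p′ q≈q′ = pointwise λ i → begin
      coeff (p +ₚ q) i         ≈⟨ coeff-+ p q i ⟩
      coeff p i + coeff q i    ≈⟨ R.+-cong (coeffs p≈p′ i) (coeffs q≈q′ i) ⟩
      coeff p′ i + coeff q′ i  ≈⟨ coeff-+ p′ q′ i ⟨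
      coeff (p′ +ₚ q′) i       ∎

    +ₚ-assoc : ∀ p q r → ((p +ₚ q) +ₚ r) ≋ (p +ₚ (q +ₚ r))
    +ₚ-assoc p q r = pointwise λ i → begin
      coeff ((p +ₚ q) +ₚ r) i                ≈⟨ coeff-+ (p +ₚ q) r i ⟩
      coeff (p +ₚ q) i + coeff r i           ≈⟨ R.+-congʳ (coeff-+ p q i) ⟩
      (coeff p i + coeff q i) + coeff r i    ≈⟨ R.+-assoc _ _ _ ⟩
      coeff p i + (coeff q i + coeff r i)    ≈⟨ R.+-congˡ (coeff-+ q r i) ⟨
      coeff p i + coeff (q +ₚ r) i           ≈⟨ coeff-+ p (q +ₚ r) i ⟨
      coeff (p +ₚ (q +ₚ r)) i                ∎

    +ₚ-comm : ∀ p q → (p +ₚ q) ≋ (q +ₚ p)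
    +ₚ-comm p q = pointwise λ i → begin
      coeff (p +ₚ q) i       ≈⟨ coeff-+ p q i ⟩
      coeff p i + coeff q i  ≈⟨ R.+-comm _ _ ⟩
      coeff q i + coeff p i  ≈⟨ coeff-+ q p i ⟨
      coeff (q +ₚ p) i       ∎

    +ₚ-identityʳ : ∀ p → (p +ₚ []) ≋ p
    +ₚ-identityʳ p = pointwise λ i → R.trans (coeff-+ p [] i) (R.+-identityʳ _)

    ·-cong : ∀ {a b p q} → a ≈ b → p ≋ q → (a · p) ≋ (b · q)
    ·-cong {a} {b} {p} {q} a≈b p≈q = pointwise λ i → begin
      coeff (a · p) i  ≈⟨ coeff-· a p i ⟩
      a * coeff p i    ≈⟨ R.*-cong a≈b (coeffs p≈q i) ⟩
      b * coeff q i    ≈⟨ coeff-· b q i ⟨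
      coeff (b · q) i  ∎

    ·-distribˡ : ∀ a p q → (a · (p +ₚ q)) ≋ ((a · p) +ₚ (a · q))
    ·-distribˡ a p q = pointwise λ i → begin
      coeff (a · (p +ₚ q)) i             ≈⟨ coeff-· a (p +ₚ q) i ⟩
      a * coeff (p +ₚ q) i               ≈⟨ R.*-congˡ (coeff-+ p q i) ⟩
      a * (coeff p i + coeff q i)        ≈⟨ R.distribˡ _ _ _ ⟩
      a * coeff p i + a * coeff q i      ≈⟨ R.+-cong (coeff-· a p i) (coeff-· a q i) ⟨
      coeff (a · p) i + coeff (a · q) i  ≈⟨ coeff-+ (a · p) (a · q) i ⟨
      coeff ((a · p) +ₚ (a · q)) i       ∎

    ·-assoc : ∀ a b p → ((a * b) · p) ≋ (a · (b · p))
    ·-assoc a b p = pointwise λ i → begin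
      coeff ((a * b) · p) i    ≈⟨ coeff-· (a * b) p i ⟩
      (a * b) * coeff p i      ≈⟨ R.*-assoc _ _ _ ⟩
      a * (b * coeff p i)      ≈⟨ R.*-congˡ (coeff-· b p i) ⟨
      a * coeff (b · p) i      ≈⟨ coeff-· a (b · p) i ⟨
      coeff (a · (b · p)) i    ∎

    ·-identity : ∀ p → (1# · p) ≋ p
    ·-identity p = pointwise λ i → R.trans (coeff-· 1# p i) (R.*-identityˡ _)

    ·-zero : ∀ p → (0# · p) ≋ []
    ·-zero p = pointwise λ i → R.trans (coeff-· 0# p i) (R.zeroˡ _)

    ∷-cong : ∀ {a b p q} → a ≈ b → p ≋ q → (a ∷ p) ≋ (b ∷ q)
    ∷-cong a≈b p≈q = pointwise λ { zero → a≈b ; (suc i) → coeffs p≈q i }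

  open SetoidReasoning ≋-setoid

  shift-cong : ∀ {p q} → p ≋ q → shift p ≋ shift q
  shift-cong = ∷-cong R.refl

  shift-[] : shift [] ≋ []
  shift-[] = pointwise λ { zero → R.refl ; (suc i) → R.refl }

  shift-+ : ∀ p q → shift (p +ₚ q) ≋ (shift p +ₚ shift q)
  shift-+ p q = ∷-cong (R.sym (R.+-identityˡ 0#)) P.refl

  ·-shift : ∀ a p → (a · shift p) ≋ shift (a · p)
  ·-shift a p = ∷-cong (R.zeroʳ a) P.refl


  *ₚ-zeroʳ : ∀ p → (p *ₚ []) ≋ []
  *ₚ-zeroʳ []      = P.refl
  *ₚ-zeroʳ (a ∷ p) = P.trans (shift-cong (*ₚ-zeroʳ p)) shift-[]

  *ₚ-congˡ : ∀ p {q q′} → q ≋ q′ → (p *ₚ q) ≋ (p *ₚ q′)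
  *ₚ-congˡ []      q≈q′ = P.refl
  *ₚ-congˡ (a ∷ p) q≈q′ = +ₚ-cong (·-cong R.refl q≈q′) (shift-cong (*ₚ-congˡ p q≈q′))

  +ₚ-interchange : ∀ p q r s → ((p +ₚ q) +ₚ (r +ₚ s)) ≋ ((p +ₚ r) +ₚ (q +ₚ s))
  +ₚ-interchange p q r s = begin
    (p +ₚ q) +ₚ (r +ₚ s)    ≈⟨ +ₚ-assoc p q (r +ₚ s) ⟩
    p +ₚ (q +ₚ (r +ₚ s))    ≈⟨ +ₚ-cong {p} P.refl (+ₚ-assoc q r s) ⟨
    p +ₚ ((q +ₚ r) +ₚ s)    ≈⟨ +ₚ-cong {p} P.refl (+ₚ-cong (+ₚ-comm q r) P.refl) ⟩
    p +ₚ ((r +ₚ q) +ₚ s)    ≈⟨ +ₚ-cong {p} P.refl (+ₚ-assoc r q s) ⟩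
    p +ₚ (r +ₚ (q +ₚ s))    ≈⟨ +ₚ-assoc p r (q +ₚ s) ⟨
    (p +ₚ r) +ₚ (q +ₚ s)    ∎

  *ₚ-distribˡ : ∀ p q r → (p *ₚ (q +ₚ r)) ≋ ((p *ₚ q) +ₚ (p *ₚ r))
  *ₚ-distribˡ []      q r = P.refl
  *ₚ-distribˡ (a ∷ p) q r = begin
    (a · (q +ₚ r)) +ₚ shift (p *ₚ (q +ₚ r))
      ≈⟨ +ₚ-cong (·-distribˡ a q r) (shift-cong (*ₚ-distribˡ p q r)) ⟩
    ((a · q) +ₚ (a · r)) +ₚ shift ((p *ₚ q) +ₚ (p *ₚ r))
      ≈⟨ +ₚ-cong P.refl (shift-+ (p *ₚ q) (p *ₚ r)) ⟩
    ((a · q) +ₚ (a · r)) +ₚ (shift (p *ₚ q) +ₚ shift (p *ₚ r))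
      ≈⟨ +ₚ-interchange (a · q) (a · r) (shift (p *ₚ q)) (shift (p *ₚ r)) ⟩
    ((a ∷ p) *ₚ q) +ₚ ((a ∷ p) *ₚ r) ∎

  *ₚ-shiftʳ : ∀ p q → (p *ₚ shift q) ≋ shift (p *ₚ q)
  *ₚ-shiftʳ []      q = P.sym shift-[]
  *ₚ-shiftʳ (a ∷ p) q = P.trans
    (+ₚ-cong (·-shift a q) (shift-cong (*ₚ-shiftʳ p q)))
    (P.sym (shift-+ (a · q) (shift (p *ₚ q))))

  *ₚ-constantʳ : ∀ p b → (p *ₚ constant b) ≋ (b · p)
  *ₚ-constantʳ []      b = P.refl
  *ₚ-constantʳ (a ∷ p) b =
    ∷-cong (R.trans (R.+-identityʳ _) (R.*-comm a b)) (*ₚ-constantʳ p b)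

  -- The product recurses on its left factor only. Splitting `a ∷ p` as `constant a +ₚ shift p`
  -- gives the same recursion on the right; right distributivity and congruence in the left factor
  -- then follow by commuting.
  *ₚ-comm : ∀ p q → (p *ₚ q) ≋ (q *ₚ p)
  *ₚ-comm []      q = P.sym (*ₚ-zeroʳ q)
  *ₚ-comm (a ∷ p) q = begin
    (a · q) +ₚ shift (p *ₚ q)            ≈⟨ +ₚ-cong (*ₚ-constantʳ q a) (shift-cong (*ₚ-comm q p)) ⟨
    (q *ₚ constant a) +ₚ shift (q *ₚ p)  ≈⟨ +ₚ-cong P.refl (*ₚ-shiftʳ q p) ⟨
    (q *ₚ constant a) +ₚ (q *ₚ shift p)  ≈⟨ *ₚ-distribˡ q (constant a) (shift p) ⟨
    q *ₚ (constant a +ₚ shift p)         ≈⟨ *ₚ-congˡ q (∷-cong (R.+-identityʳ a) P.refl) ⟩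
    q *ₚ (a ∷ p)                         ∎

  *ₚ-distribʳ : ∀ p q r → ((q +ₚ r) *ₚ p) ≋ ((q *ₚ p) +ₚ (r *ₚ p))
  *ₚ-distribʳ p q r = begin
    (q +ₚ r) *ₚ p         ≈⟨ *ₚ-comm (q +ₚ r) p ⟩
    p *ₚ (q +ₚ r)         ≈⟨ *ₚ-distribˡ p q r ⟩
    (p *ₚ q) +ₚ (p *ₚ r)  ≈⟨ +ₚ-cong (*ₚ-comm p q) (*ₚ-comm p r) ⟩
    (q *ₚ p) +ₚ (r *ₚ p)  ∎

  *ₚ-cong : ∀ {p p′ q q′} → p ≋ p′ → q ≋ q′ → (p *ₚ q) ≋ (p′ *ₚ q′)
  *ₚ-cong {p} {p′} {q} {q′} p≈p′ q≈q′ = begin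
    p *ₚ q    ≈⟨ *ₚ-congˡ p q≈q′ ⟩
    p *ₚ q′   ≈⟨ *ₚ-comm p q′ ⟩
    q′ *ₚ p   ≈⟨ *ₚ-congˡ q′ p≈p′ ⟩
    q′ *ₚ p′  ≈⟨ *ₚ-comm q′ p′ ⟩
    p′ *ₚ q′  ∎

  ·-*ₚ : ∀ a p q → ((a · p) *ₚ q) ≋ (a · (p *ₚ q))
  ·-*ₚ a []      q = P.refl
  ·-*ₚ a (b ∷ p) q = begin
    ((a * b) · q) +ₚ shift ((a · p) *ₚ q)  ≈⟨ +ₚ-cong (·-assoc a b q) (shift-cong (·-*ₚ a p q)) ⟩
    (a · (b · q)) +ₚ shift (a · (p *ₚ q))  ≈⟨ +ₚ-cong P.refl (·-shift a (p *ₚ q)) ⟨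
    (a · (b · q)) +ₚ (a · shift (p *ₚ q))  ≈⟨ ·-distribˡ a (b · q) (shift (p *ₚ q)) ⟨
    a · ((b ∷ p) *ₚ q)                     ∎

  *ₚ-shiftˡ : ∀ p q → (shift p *ₚ q) ≋ shift (p *ₚ q)
  *ₚ-shiftˡ p q = +ₚ-cong (·-zero q) P.refl

  *ₚ-assoc : ∀ p q r → ((p *ₚ q) *ₚ r) ≋ (p *ₚ (q *ₚ r))
  *ₚ-assoc []      q r = P.refl
  *ₚ-assoc (a ∷ p) q r = begin
    ((a · q) +ₚ shift (p *ₚ q)) *ₚ r          ≈⟨ *ₚ-distribʳ r (a · q) (shift (p *ₚ q)) ⟩
    ((a · q) *ₚ r) +ₚ (shift (p *ₚ q) *ₚ r)   ≈⟨ +ₚ-cong (·-*ₚ a q r) (*ₚ-shiftˡ (p *ₚ q) r) ⟩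
    (a · (q *ₚ r)) +ₚ shift ((p *ₚ q) *ₚ r)   ≈⟨ +ₚ-cong P.refl (shift-cong (*ₚ-assoc p q r)) ⟩
    (a ∷ p) *ₚ (q *ₚ r)                       ∎

  *ₚ-identityˡ : ∀ p → (constant 1# *ₚ p) ≋ p
  *ₚ-identityˡ p = P.trans (+ₚ-cong (·-identity p) shift-[]) (+ₚ-identityʳ p)

  -- This structure allows polynomials to be the values of an evaluation, as substitution into
  -- ℤ[x,y] requires.
  +ₚ-*ₚ-isCommutativeSemiring :
    IsCommutativeSemiring _≋_ _+ₚ_ _*ₚ_ [] (constant 1#)
  +ₚ-*ₚ-isCommutativeSemiring = Biased.isCommutativeSemiringˡ (record
    { +-isCommutativeMonoid = Biased.isCommutativeMonoidˡ (record
      { isSemigroup = record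
        { isMagma = record { isEquivalence = P.isEquivalence ; ∙-cong = +ₚ-cong }
        ; assoc   = +ₚ-assoc
        }
      ; identityˡ = λ p → P.refl
      ; comm      = +ₚ-comm
      })
    ; *-isCommutativeMonoid = Biased.isCommutativeMonoidˡ (record
      { isSemigroup = record
        { isMagma = record { isEquivalence = P.isEquivalence ; ∙-cong = *ₚ-cong }
        ; assoc   = *ₚ-assoc
        }
      ; identityˡ = *ₚ-identityˡ
      ; comm      = *ₚ-comm
      })
    ; distribʳ = *ₚ-distribʳ
    ; zeroˡ    = λ p → P.refl
    })

-- Evaluation as a homomorphism

module EvaluateProperties {c ℓ c′ ℓ′ ℓ″} (R : RawRing c ℓ) (S : RawRing c′ ℓ′)
  -- The equality on `S` is a separate parameter, so that `_≋_` can stand in for the equality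
  -- carried by ℤ[x].
  {_∼_ : Rel (RawRing.Carrier S) ℓ″}
  (isCommutativeSemiring : IsCommutativeSemiring _∼_
    (RawRing._+_ S) (RawRing._*_ S) (RawRing.0# S) (RawRing.1# S))
  (φ : RawRing.Carrier R → RawRing.Carrier S)
  (φ-+ : ∀ a b → φ (RawRing._+_ R a b) ∼ RawRing._+_ S (φ a) (φ b))
  (φ-* : ∀ a b → φ (RawRing._*_ R a b) ∼ RawRing._*_ S (φ a) (φ b))
  (φ-0 : φ (RawRing.0# R) ∼ RawRing.0# S)
  (s : RawRing.Carrier S) where

  open RawRing S using (Carrier; _+_; _*_)
  open Polynomial R using (Poly; _+ₚ_; _*ₚ_)
  private
    S-semiring : CommutativeSemiring c′ ℓ″
    S-semiring = record { isCommutativeSemiring = isCommutativeSemiring }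
    module S = CommutativeSemiring S-semiring
    module R = RawRing R
  open S using (_≈_)
  open SetoidReasoning S.setoid

  private
    ev : Poly → Carrier
    ev = evaluate R S φ s

  open CommutativeSemigroupProperties S.+-commutativeSemigroup
    using () renaming (interchange to +-interchange)
  open CommutativeSemigroupProperties S.*-commutativeSemigroup
    using () renaming (x∙yz≈y∙xz to *-x∙yz≈y∙xz)

  evaluate-+ : ∀ p q → ev (p +ₚ q) ≈ ev p + ev q
  evaluate-+ []      q       = S.sym (S.+-identityˡ _)
  evaluate-+ (a ∷ p) []      = S.sym (S.+-identityʳ _)
  evaluate-+ (a ∷ p) (b ∷ q) = begin
    φ _ + s * ev (p +ₚ q)
      ≈⟨ S.+-cong (φ-+ a b) (S.trans (S.*-congˡ (evaluate-+ p q)) (S.distribˡ _ _ _)) ⟩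
    (φ a + φ b) + (s * ev p + s * ev q)    ≈⟨ +-interchange _ _ _ _ ⟩
    (φ a + s * ev p) + (φ b + s * ev q)    ∎

  evaluate-scale : ∀ a p → ev (map (a R.*_) p) ≈ φ a * ev p
  evaluate-scale a []      = S.sym (S.zeroʳ _)
  evaluate-scale a (b ∷ p) = begin
    φ _ + s * ev (map (a R.*_) p)
      ≈⟨ S.+-cong (φ-* a b) (S.*-congˡ (evaluate-scale a p)) ⟩
    φ a * φ b + s * (φ a * ev p)   ≈⟨ S.+-congˡ (*-x∙yz≈y∙xz _ _ _) ⟩
    φ a * φ b + φ a * (s * ev p)   ≈⟨ S.distribˡ _ _ _ ⟨
    φ a * (φ b + s * ev p)         ∎

  evaluate-* : ∀ p q → ev (p *ₚ q) ≈ ev p * ev q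
  evaluate-* []      q = S.sym (S.zeroˡ _)
  evaluate-* (a ∷ p) q = begin
    ev (map (a R.*_) q +ₚ (R.0# ∷ (p *ₚ q)))
      ≈⟨ evaluate-+ (map (a R.*_) q) (R.0# ∷ (p *ₚ q)) ⟩
    ev (map (a R.*_) q) + (φ R.0# + s * ev (p *ₚ q))
      ≈⟨ S.+-cong (evaluate-scale a q) (S.trans (S.+-congʳ φ-0) (S.+-identityˡ _)) ⟩
    φ a * ev q + s * ev (p *ₚ q)     ≈⟨ S.+-congˡ (S.*-congˡ (evaluate-* p q)) ⟩
    φ a * ev q + s * (ev p * ev q)   ≈⟨ S.+-congˡ (S.*-assoc _ _ _) ⟨
    φ a * ev q + (s * ev p) * ev q   ≈⟨ S.distribʳ _ _ _ ⟨
    (φ a + s * ev p) * ev q          ∎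

-- Sums over all subsets

open import Data.Nat.Base
  using (_+_; _*_; _∸_; _⊓_; ∣_-_∣; _≤_; _<_; _≡ᵇ_; _<ᵇ_; z≤n; s≤s; s≤s⁻¹; z<s;
         NonZero)
open import Data.Nat.Combinatorics using (_C_; nCk+nC[k+1]≡[n+1]C[k+1])
open import Data.Nat.DivMod
  using (_%_; _/_; m≡m%n+[m/n]*n; [m+kn]%n≡m%n; m<n⇒m%n≡m; m%n<n)
open import Data.Nat.ListAction using (sum)
open import Data.Nat.ListAction.Properties using (sum-++)
open import Data.Nat.Properties
open CommutativeSemigroupProperties +-commutativeSemigroup
  using (x∙yz≈y∙xz) renaming (interchange to +-interchange)

𝟙 : Bool → ℕ
𝟙 true  = 1
𝟙 false = 0

-- Recursion on the ground set, instead of along the list `subsets n`, splits a sum by membership of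
-- the first element, which is how Pascal's rule enters in `∑-size`.
∑ : ∀ {n} → (Subset n → ℕ) → ℕ
∑ {zero}  f = f []
∑ {suc n} f = ∑ (λ A → f (outside ∷ A)) + ∑ (λ A → f (inside ∷ A))

sum-map-subsets : ∀ n (f : Subset n → ℕ) → sum (map f (subsets n)) ≡ ∑ f
sum-map-subsets zero    f = +-identityʳ _
sum-map-subsets (suc n) f = begin
  sum (map f (S₀ ++ S₁))              ≡⟨ cong sum (map-++ f S₀ S₁) ⟩
  sum (map f S₀ ++ map f S₁)          ≡⟨ sum-++ (map f S₀) (map f S₁) ⟩
  sum (map f S₀) + sum (map f S₁)
    ≡⟨ cong₂ (λ k l → sum k + sum l) (map-∘ (subsets n)) (map-∘ (subsets n)) ⟨
  sum (map (f ∘ (outside ∷_)) (subsets n)) + sum (map (f ∘ (inside ∷_)) (subsets n))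
    ≡⟨ cong₂ _+_ (sum-map-subsets n _) (sum-map-subsets n _) ⟩
  ∑ f ∎
  where
  open ≡-Reasoning
  S₀ = map (outside ∷_) (subsets n)
  S₁ = map (inside ∷_) (subsets n)

∑-cong : ∀ {n} {f g : Subset n → ℕ} → (∀ A → f A ≡ g A) → ∑ f ≡ ∑ g
∑-cong {zero}  f≗g = f≗g []
∑-cong {suc n} f≗g = cong₂ _+_ (∑-cong (f≗g ∘ (outside ∷_))) (∑-cong (f≗g ∘ (inside ∷_)))

∑-+ : ∀ {n} (f g : Subset n → ℕ) → ∑ (λ A → f A + g A) ≡ ∑ f + ∑ g
∑-+ {zero}  f g = refl
∑-+ {suc n} f g =
  trans (cong₂ _+_ (∑-+ (f ∘ (outside ∷_)) (g ∘ (outside ∷_)))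
                   (∑-+ (f ∘ (inside ∷_)) (g ∘ (inside ∷_))))
        (+-interchange (∑ (f ∘ (outside ∷_))) _ _ _)

∑-*ʳ : ∀ {n} (f : Subset n → ℕ) c → ∑ (λ A → f A * c) ≡ ∑ f * c
∑-*ʳ {zero}  f c = refl
∑-*ʳ {suc n} f c = trans (cong₂ _+_ (∑-*ʳ (f ∘ (outside ∷_)) c) (∑-*ʳ (f ∘ (inside ∷_)) c))
                         (sym (*-distribʳ-+ c (∑ (f ∘ (outside ∷_))) _))

∑-zero : ∀ n → ∑ {n} (λ _ → 0) ≡ 0
∑-zero zero    = refl
∑-zero (suc n) = cong₂ _+_ (∑-zero n) (∑-zero n)

term≤∑ : ∀ {n} (f : Subset n → ℕ) A → f A ≤ ∑ f
term≤∑ f []            = ≤-refl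
term≤∑ f (outside ∷ A) = ≤-trans (term≤∑ (f ∘ (outside ∷_)) A) (m≤m+n _ _)
term≤∑ f (inside  ∷ A) = ≤-trans (term≤∑ (f ∘ (inside ∷_)) A) (m≤n+m _ _)

∑-size : ∀ n k → ∑ {n} (λ A → 𝟙 (∣ A ∣ ≡ᵇ k)) ≡ n C k
∑-size zero    zero    = refl
∑-size zero    (suc k) = refl
∑-size (suc n) zero    = cong₂ _+_ (∑-size n 0) (∑-zero n)
∑-size (suc n) (suc k) = begin
  ∑ {n} (λ A → 𝟙 (∣ A ∣ ≡ᵇ suc k)) + ∑ {n} (λ A → 𝟙 (∣ A ∣ ≡ᵇ k))
    ≡⟨ cong₂ _+_ (∑-size n (suc k)) (∑-size n k) ⟩
  n C suc k + n C k      ≡⟨ +-comm (n C suc k) _ ⟩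
  n C k + n C suc k      ≡⟨ nCk+nC[k+1]≡[n+1]C[k+1] n k ⟩
  suc n C suc k          ∎
  where open ≡-Reasoning

𝟙-∧ : ∀ a b → 𝟙 (a ∧ b) ≡ 𝟙 a * 𝟙 b
𝟙-∧ true  b = sym (*-identityˡ _)
𝟙-∧ false b = refl

𝟙-<ᵇ-suc : ∀ m n → 𝟙 (m <ᵇ suc n) ≡ 𝟙 (m <ᵇ n) + 𝟙 (m ≡ᵇ n)
𝟙-<ᵇ-suc zero    zero    = refl
𝟙-<ᵇ-suc zero    (suc n) = refl
𝟙-<ᵇ-suc (suc m) zero    = refl
𝟙-<ᵇ-suc (suc m) (suc n) = 𝟙-<ᵇ-suc m n

-- Induction on the number of labels: either the class of the last label is heavier than `k`, or
-- discarding it costs at most `k` and the bound survives for the remaining labels.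
pigeonhole : ∀ {n} (label weight : Subset n → ℕ) m k →
  m * k < ∑ (λ A → 𝟙 (label A <ᵇ m) * weight A) →
  ∃[ c ] k < ∑ (λ A → 𝟙 (label A ≡ᵇ c) * weight A)
pigeonhole {n} label weight zero    k lt = contradiction (subst (0 <_) (∑-zero n) lt) λ ()
pigeonhole {n} label weight (suc m) k lt with k <? ∑ (λ A → 𝟙 (label A ≡ᵇ m) * weight A)
... | yes k<class = m , k<class
... | no  k≮class = pigeonhole label weight m k (+-cancelˡ-< k _ _ (begin-strict
  k + m * k                                  <⟨ lt ⟩
  ∑ (λ A → 𝟙 (label A <ᵇ suc m) * weight A)  ≡⟨ ∑-cong split ⟩
  ∑ (λ A → below A + at A)                   ≡⟨ ∑-+ below at ⟩
  ∑ below + ∑ at                             ≤⟨ +-monoʳ-≤ (∑ below) (≮⇒≥ k≮class) ⟩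
  ∑ below + k                                ≡⟨ +-comm (∑ below) k ⟩
  k + ∑ below                                ∎))
  where
  open ≤-Reasoning
  below at : Subset n → ℕ
  below A = 𝟙 (label A <ᵇ m) * weight A
  at    A = 𝟙 (label A ≡ᵇ m) * weight A
  split : ∀ A → 𝟙 (label A <ᵇ suc m) * weight A ≡ below A + at A
  split A = trans (cong (_* weight A) (𝟙-<ᵇ-suc (label A) m))
                  (*-distribʳ-+ (weight A) (𝟙 (label A <ᵇ m)) _)

-- Coefficients of T_M(x + 1 , x + 1)

open PolynomialProperties ℤ-ring ℤ.+-*-isCommutativeSemiring
open Polynomial ℤ-ring using (Poly; coeff; constant; HasDegree)

private
  module P  = RawRing ℤ[x,y]
  module Q  = RawRing ℤ[x]
  module ≋ = Setoid ≋-setoid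
  open RawSemiringDefs P.rawSemiring using (_^_)

  constant-+ : ∀ a b → constant (a ℤ.+ b) ≋ (constant a Q.+ constant b)
  constant-+ a b = ≋.refl

  constant-* : ∀ a b → constant (a ℤ.* b) ≋ (constant a Q.* constant b)
  constant-* a b = ∷-cong (sym (ℤ.+-identityʳ _)) ≋.refl

  -- Substitution is a nested evaluation: `Inner` replaces x in the coefficients, and being a
  -- homomorphism it serves as the coefficient map of `Outer`, which replaces y.
  module Inner = EvaluateProperties ℤ-ring ℤ[x] +ₚ-*ₚ-isCommutativeSemiring
    constant constant-+ constant-* shift-[] x+1

  module Outer = EvaluateProperties ℤ[x] ℤ[x] +ₚ-*ₚ-isCommutativeSemiring
    (evaluate ℤ-ring ℤ[x] constant x+1)
    Inner.evaluate-+ Inner.evaluate-* ≋.refl x+1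

diagonal : P.Carrier → Q.Carrier
diagonal f = substitute f x+1 x+1

monomial : ℕ → Poly
monomial zero    = constant ℤ.1ℤ
monomial (suc d) = shift (monomial d)

coeff-monomial : ∀ d i → coeff (monomial d) i ≡ ℤ.+ 𝟙 (d ≡ᵇ i)
coeff-monomial zero    zero    = refl
coeff-monomial zero    (suc i) = refl
coeff-monomial (suc d) zero    = refl
coeff-monomial (suc d) (suc i) = coeff-monomial d i

monomial-* : ∀ a b → (monomial a Q.* monomial b) ≋ monomial (a + b)
monomial-* zero    b = *ₚ-identityˡ (monomial b)
monomial-* (suc a) b = ≋.trans (*ₚ-shiftˡ (monomial a) (monomial b)) (shift-cong (monomial-* a b))

diagonal-^ : ∀ f → diagonal f ≋ monomial 1 → ∀ a → diagonal (f ^ a) ≋ monomial a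
diagonal-^ f f≋t zero    = pointwise λ { 0 → refl ; 1 → refl ; (suc (suc i)) → refl }
diagonal-^ f f≋t (suc a) = begin
  diagonal (f P.* f ^ a)           ≈⟨ Outer.evaluate-* f (f ^ a) ⟩
  diagonal f Q.* diagonal (f ^ a)  ≈⟨ *ₚ-cong f≋t (diagonal-^ f f≋t a) ⟩
  monomial 1 Q.* monomial a        ≈⟨ monomial-* 1 a ⟩
  monomial (suc a)                 ∎
  where open SetoidReasoning ≋-setoid

-- Here the shift by one pays off: x - 1 and y - 1 both become the variable, so each Tutte term
-- becomes a monomial. The evaluated list carries a trailing zero, hence the separate case for index
-- 2.
diagonal-x-1 : diagonal (x P.+ (P.- P.1#)) ≋ monomial 1
diagonal-x-1 = pointwise λ { 0 → refl ; 1 → refl ; 2 → refl ; (suc (suc (suc i))) → refl }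

diagonal-y-1 : diagonal (y P.+ (P.- P.1#)) ≋ monomial 1
diagonal-y-1 = pointwise λ { 0 → refl ; 1 → refl ; 2 → refl ; (suc (suc (suc i))) → refl }

module _ {n} (M : Matroid n) where
  open Matroid M

  corank+nullity : Subset n → ℕ
  corank+nullity A = (rk ⊤ ∸ rk A) + (∣ A ∣ ∸ rk A)

  diagonal-tutteTerm : ∀ A → diagonal (tutteTerm M A) ≋ monomial (corank+nullity A)
  diagonal-tutteTerm A = begin
    diagonal (tutteTerm M A)
      ≈⟨ Outer.evaluate-* ((x P.+ (P.- P.1#)) ^ a) ((y P.+ (P.- P.1#)) ^ b) ⟩
    diagonal ((x P.+ (P.- P.1#)) ^ a) Q.* diagonal ((y P.+ (P.- P.1#)) ^ b)
      ≈⟨ *ₚ-cong (diagonal-^ _ diagonal-x-1 a) (diagonal-^ _ diagonal-y-1 b) ⟩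
    monomial a Q.* monomial b  ≈⟨ monomial-* a b ⟩
    monomial (a + b)           ∎
    where
    open SetoidReasoning ≋-setoid
    a = rk ⊤ ∸ rk A
    b = ∣ A ∣ ∸ rk A

  -- Each subset contributes a single monomial with coefficient 1, so from here on polynomial
  -- arithmetic is replaced by counting subsets.
  coeff-diagonalTutte : ∀ i →
    coeff (diagonalTutte M) i ≡ ℤ.+ ∑ (λ A → 𝟙 (corank+nullity A ≡ᵇ i))
  coeff-diagonalTutte i = trans (sums (subsets n)) (cong ℤ.+_ (sum-map-subsets n _))
    where
    open ≡-Reasoning
    f : Subset n → ℕ
    f A = 𝟙 (corank+nullity A ≡ᵇ i)
    sums : ∀ As → coeff (diagonal (foldr (λ A s → tutteTerm M A P.+ s) P.0# As)) i
                ≡ ℤ.+ sum (map f As)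
    sums []       = refl
    sums (A ∷ As) = begin
      coeff (diagonal (tutteTerm M A P.+ rest)) i
        ≡⟨ coeffs (Outer.evaluate-+ (tutteTerm M A) rest) i ⟩
      coeff (diagonal (tutteTerm M A) Q.+ diagonal rest) i
        ≡⟨ coeff-+ (diagonal (tutteTerm M A)) (diagonal rest) i ⟩
      coeff (diagonal (tutteTerm M A)) i ℤ.+ coeff (diagonal rest) i
        ≡⟨ cong₂ ℤ._+_
             (trans (coeffs (diagonal-tutteTerm A) i) (coeff-monomial (corank+nullity A) i))
             (sums As) ⟩
      ℤ.+ (f A + sum (map f As)) ∎
      where rest = foldr (λ A s → tutteTerm M A P.+ s) P.0# As

-- Sparse paving matroids

∣p∪q∣+∣p∩q∣≡∣p∣+∣q∣ : ∀ {n} (p q : Subset n) → ∣ p ∪ q ∣ + ∣ p ∩ q ∣ ≡ ∣ p ∣ + ∣ q ∣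
∣p∪q∣+∣p∩q∣≡∣p∣+∣q∣ []            []            = refl
∣p∪q∣+∣p∩q∣≡∣p∣+∣q∣ (outside ∷ p) (outside ∷ q) = ∣p∪q∣+∣p∩q∣≡∣p∣+∣q∣ p q
∣p∪q∣+∣p∩q∣≡∣p∣+∣q∣ (inside  ∷ p) (outside ∷ q) = cong suc (∣p∪q∣+∣p∩q∣≡∣p∣+∣q∣ p q)
∣p∪q∣+∣p∩q∣≡∣p∣+∣q∣ (outside ∷ p) (inside  ∷ q) =
  trans (cong suc (∣p∪q∣+∣p∩q∣≡∣p∣+∣q∣ p q)) (sym (+-suc _ _))
∣p∪q∣+∣p∩q∣≡∣p∣+∣q∣ (inside  ∷ p) (inside  ∷ q) =
  cong suc (trans (+-suc _ _) (trans (cong suc (∣p∪q∣+∣p∩q∣≡∣p∣+∣q∣ p q)) (sym (+-suc _ _))))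

∣p∣≤∣p∩q∣⇒p⊆q : ∀ {n} (p q : Subset n) → ∣ p ∣ ≤ ∣ p ∩ q ∣ → p ⊆ q
∣p∣≤∣p∩q∣⇒p⊆q (outside ∷ p) (_       ∷ q) le (there x∈p) = there (∣p∣≤∣p∩q∣⇒p⊆q p q le x∈p)
∣p∣≤∣p∩q∣⇒p⊆q (inside  ∷ p) (inside  ∷ q) le here        = here
∣p∣≤∣p∩q∣⇒p⊆q (inside  ∷ p) (inside  ∷ q) le (there x∈p) =
  there (∣p∣≤∣p∩q∣⇒p⊆q p q (s≤s⁻¹ le) x∈p)
∣p∣≤∣p∩q∣⇒p⊆q (inside  ∷ p) (outside ∷ q) le _           =
  contradiction (≤-trans le (∣p∩q∣≤∣p∣ p q)) (<-irrefl refl)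

p⊆q⇒p∩q≡p : ∀ {n} {p q : Subset n} → p ⊆ q → p ∩ q ≡ p
p⊆q⇒p∩q≡p {p = p} {q} p⊆q = ⊆-antisym (p∩q⊆p p q) λ x∈p → x∈p∩q⁺ (x∈p , p⊆q x∈p)

p⊆q⇒p∪q≡q : ∀ {n} {p q : Subset n} → p ⊆ q → p ∪ q ≡ q
p⊆q⇒p∪q≡q {p = p} {q} p⊆q =
  ⊆-antisym (λ x∈p∪q → [ p⊆q , id ]′ (x∈p∪q⁻ p q x∈p∪q))
            (λ x∈q → subst (_ ∈_) (∪-comm q p) (p⊆p∪q p x∈q))

p⊈q⇒∣p∩q∣<∣p∣ : ∀ {n} {p q : Subset n} → ¬ p ⊆ q → ∣ p ∩ q ∣ < ∣ p ∣
p⊈q⇒∣p∩q∣<∣p∣ {p = p} {q} p⊈q = ≰⇒> (p⊈q ∘ ∣p∣≤∣p∩q∣⇒p⊆q p q)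

-- Truncation at `t` is a concave function, and `a`, `b` lie between `i` and `u` with the same sum.
-- For sizes of sets this is submodularity of the uniform matroid.
⊓-concave : ∀ {u i a b} t → u + i ≡ a + b → i ≤ a → i ≤ b →
            (u ⊓ t) + (i ⊓ t) ≤ (a ⊓ t) + (b ⊓ t)
⊓-concave {u} {i} {a} {b} t u+i≡a+b i≤a i≤b with ≤-total a t | ≤-total b t
... | inj₁ a≤t | inj₁ b≤t = begin
  (u ⊓ t) + (i ⊓ t)  ≤⟨ +-mono-≤ (m⊓n≤m u t) (m⊓n≤m i t) ⟩
  u + i              ≡⟨ u+i≡a+b ⟩
  a + b              ≡⟨ cong₂ _+_ (m≤n⇒m⊓n≡m a≤t) (m≤n⇒m⊓n≡m b≤t) ⟨
  (a ⊓ t) + (b ⊓ t)  ∎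
  where open ≤-Reasoning
... | inj₂ t≤a | _        = begin
  (u ⊓ t) + (i ⊓ t)  ≤⟨ +-mono-≤ (m⊓n≤n u t) (⊓-monoˡ-≤ t i≤b) ⟩
  t + (b ⊓ t)        ≡⟨ cong (_+ (b ⊓ t)) (m≥n⇒m⊓n≡n t≤a) ⟨
  (a ⊓ t) + (b ⊓ t)  ∎
  where open ≤-Reasoning
... | inj₁ _   | inj₂ t≤b = begin
  (u ⊓ t) + (i ⊓ t)  ≤⟨ +-mono-≤ (m⊓n≤n u t) (⊓-monoˡ-≤ t i≤a) ⟩
  t + (a ⊓ t)        ≡⟨ cong (_+ (a ⊓ t)) (m≥n⇒m⊓n≡n t≤b) ⟨
  (b ⊓ t) + (a ⊓ t)  ≡⟨ +-comm (b ⊓ t) _ ⟩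
  (a ⊓ t) + (b ⊓ t)  ∎
  where open ≤-Reasoning

-- The rank is suc r, so that the circuit-hyperplanes, the members of ℋ, have
-- rank r.
module SparsePaving {n} (r : ℕ)
  {ℋ : Subset n → Set} (ℋ? : Decidable ℋ)
  (ℋ-size : ∀ {A} → ℋ A → ∣ A ∣ ≡ suc r)
  (ℋ-apart : ∀ {A B} → ℋ A → ℋ B → suc r ≤ suc ∣ A ∩ B ∣ → A ≡ B) where

  rank : Subset n → ℕ
  rank A = if does (ℋ? A) then r else ∣ A ∣ ⊓ suc r

  rank≤⊓ : ∀ A → rank A ≤ ∣ A ∣ ⊓ suc r
  rank≤⊓ A with ℋ? A
  ... | no  _   = ≤-refl
  ... | yes A∈ℋ = ⊓-glb (≤-trans (n≤1+n r) (≤-reflexive (sym (ℋ-size A∈ℋ)))) (n≤1+n r)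

  -- Only `B` in `ℋ` needs care: a proper subset of `B` has at most `r` elements, so the lowered
  -- rank of `B` still bounds its rank.
  rank-monotone : ∀ {A B} → A ⊆ B → rank A ≤ rank B
  rank-monotone {A} {B} A⊆B with B ⊆? A
  ... | yes B⊆A = ≤-reflexive (cong rank (⊆-antisym A⊆B B⊆A))
  ... | no  B⊈A with ℋ? B
  ...   | no  _   = ≤-trans (rank≤⊓ A) (⊓-monoˡ-≤ (suc r) (p⊆q⇒∣p∣≤∣q∣ A⊆B))
  ...   | yes B∈ℋ = ≤-trans (rank≤⊓ A) (≤-trans (m⊓n≤m ∣ A ∣ (suc r))
    (s≤s⁻¹ (≤-trans ∣A∣<∣B∣ (≤-reflexive (ℋ-size B∈ℋ)))))
    where
    ∣A∣<∣B∣ : ∣ A ∣ < ∣ B ∣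
    ∣A∣<∣B∣ = subst (λ C → ∣ C ∣ < ∣ B ∣)
      (trans (∩-comm B A) (p⊆q⇒p∩q≡p A⊆B)) (p⊈q⇒∣p∩q∣<∣p∣ B⊈A)

  submod-⊆ : ∀ {A B} → A ⊆ B → rank (A ∪ B) + rank (A ∩ B) ≤ rank A + rank B
  submod-⊆ {A} {B} A⊆B = ≤-reflexive (begin
    rank (A ∪ B) + rank (A ∩ B)
      ≡⟨ cong₂ (λ U I → rank U + rank I) (p⊆q⇒p∪q≡q A⊆B) (p⊆q⇒p∩q≡p A⊆B) ⟩
    rank B + rank A              ≡⟨ +-comm (rank B) _ ⟩
    rank A + rank B              ∎)
    where open ≡-Reasoning

  -- For incomparable sets even the uniform ranks of union and intersection obey the bound. Two
  -- members of `ℋ` lose one unit each, and `ℋ-apart` compensates by forcing the intersection to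
  -- have at most `r − 1` elements.
  submod-⊈ : ∀ {A B} → ¬ A ⊆ B → ¬ B ⊆ A →
             (∣ A ∪ B ∣ ⊓ suc r) + (∣ A ∩ B ∣ ⊓ suc r) ≤ rank A + rank B
  submod-⊈ {A} {B} A⊈B B⊈A = bound
    where
    open ≤-Reasoning
    i<a : ∣ A ∩ B ∣ < ∣ A ∣
    i<a = p⊈q⇒∣p∩q∣<∣p∣ A⊈B
    i<b : ∣ A ∩ B ∣ < ∣ B ∣
    i<b = subst (λ C → ∣ C ∣ < ∣ B ∣) (∩-comm B A) (p⊈q⇒∣p∩q∣<∣p∣ B⊈A)

    -- The intersection is strictly smaller than both sets, which gives back the unit lost by the
    -- one member of `ℋ`. Abstract sizes `a` and `b` let the argument serve both orders.
    one∈ℋ : ∀ {a b} → a ≡ suc r → ∣ A ∩ B ∣ < a → ∣ A ∩ B ∣ < b →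
          (∣ A ∪ B ∣ ⊓ suc r) + (∣ A ∩ B ∣ ⊓ suc r) ≤ r + (b ⊓ suc r)
    one∈ℋ {a} {b} a≡1+r i<a i<b = begin
      (∣ A ∪ B ∣ ⊓ suc r) + (∣ A ∩ B ∣ ⊓ suc r)
        ≤⟨ +-mono-≤ (m⊓n≤n ∣ A ∪ B ∣ (suc r)) (m⊓n≤m ∣ A ∩ B ∣ (suc r)) ⟩
      suc r + ∣ A ∩ B ∣    ≡⟨ +-suc r _ ⟨
      r + suc ∣ A ∩ B ∣    ≤⟨ +-monoʳ-≤ r (⊓-glb i<b (≤-trans i<a (≤-reflexive a≡1+r))) ⟩
      r + (b ⊓ suc r)      ∎

    bound : (∣ A ∪ B ∣ ⊓ suc r) + (∣ A ∩ B ∣ ⊓ suc r) ≤ rank A + rank B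
    bound with ℋ? A | ℋ? B
    ... | no  _   | no  _   = ⊓-concave (suc r) (∣p∪q∣+∣p∩q∣≡∣p∣+∣q∣ A B)
      (∣p∩q∣≤∣p∣ A B) (∣p∩q∣≤∣q∣ A B)
    ... | yes A∈ℋ | no  _   = one∈ℋ (ℋ-size A∈ℋ) i<a i<b
    ... | no  _   | yes B∈ℋ =
      ≤-trans (one∈ℋ (ℋ-size B∈ℋ) i<b i<a) (≤-reflexive (+-comm r _))
    ... | yes A∈ℋ | yes B∈ℋ with suc r ≤? suc ∣ A ∩ B ∣
    ...   | yes close = contradiction (λ {_} → ⊆-reflexive (ℋ-apart A∈ℋ B∈ℋ close)) A⊈B
    ...   | no  apart = begin
      (∣ A ∪ B ∣ ⊓ suc r) + (∣ A ∩ B ∣ ⊓ suc r)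
        ≤⟨ +-mono-≤ (m⊓n≤n ∣ A ∪ B ∣ (suc r)) (m⊓n≤m ∣ A ∩ B ∣ (suc r)) ⟩
      suc r + ∣ A ∩ B ∣    ≡⟨ +-suc r _ ⟨
      r + suc ∣ A ∩ B ∣    ≤⟨ +-monoʳ-≤ r (s≤s⁻¹ (≰⇒> apart)) ⟩
      r + r                ∎

  rank-submod : ∀ A B → rank (A ∪ B) + rank (A ∩ B) ≤ rank A + rank B
  rank-submod A B with A ⊆? B | B ⊆? A
  ... | yes A⊆B | _       = submod-⊆ A⊆B
  ... | no  _   | yes B⊆A = begin
    rank (A ∪ B) + rank (A ∩ B)
      ≡⟨ cong₂ (λ U I → rank U + rank I) (∪-comm A B) (∩-comm A B) ⟩
    rank (B ∪ A) + rank (B ∩ A)  ≤⟨ submod-⊆ B⊆A ⟩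
    rank B + rank A              ≡⟨ +-comm (rank B) _ ⟩
    rank A + rank B              ∎
    where open ≤-Reasoning
  ... | no  A⊈B | no  B⊈A =
    ≤-trans (+-mono-≤ (rank≤⊓ (A ∪ B)) (rank≤⊓ (A ∩ B))) (submod-⊈ A⊈B B⊈A)

  matroid : Matroid n
  matroid = record
    { rk          = rank
    ; rk-bounded  = λ A → ≤-trans (rank≤⊓ A) (m⊓n≤m _ _)
    ; rk-monotone = rank-monotone
    ; rk-submod   = rank-submod
    }

-- Coefficients for sparse paving matroids

𝟙-distance-far : ∀ {a b} k → a < b → 𝟙 (∣ k - a ∣ ≡ᵇ b) ≡ 𝟙 (k ≡ᵇ a + b)
𝟙-distance-far {zero}  {b} zero a<b = refl
𝟙-distance-far {suc a} {b} zero a<b = cong 𝟙 (dec-false (suc a ≟ b) (<⇒≢ a<b))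
𝟙-distance-far {zero}  {b} (suc k) a<b = refl
𝟙-distance-far {suc a} {b} (suc k) a<b = 𝟙-distance-far k (<-trans (n<1+n a) a<b)

-- A positive radius makes the two points at that distance distinct, so their indicators add up.
-- Writing the centre as `s + suc j` keeps the lower point `s` a natural number without subtraction.
𝟙-distance : ∀ s j k →
  𝟙 (∣ k - (s + suc j) ∣ ≡ᵇ suc j) ≡ 𝟙 (k ≡ᵇ s) + 𝟙 (k ≡ᵇ s + suc j + suc j)
𝟙-distance zero    j zero    = cong 𝟙 (dec-true (j ≟ j) refl)
𝟙-distance zero    j (suc k) = 𝟙-distance-far k ≤-refl
𝟙-distance (suc s) j zero    = cong 𝟙 (dec-false (s + suc j ≟ j) (<⇒≢ (m≤n+m (suc j) s) ∘ sym))
𝟙-distance (suc s) j (suc k) = 𝟙-distance s j k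

-- One summand vanishes, according to which of `k` and `t` is larger: in a uniform matroid every set
-- is independent or spanning.
[t∸k⊓t]+[k∸k⊓t]≡∣k-t∣ : ∀ k t → (t ∸ k ⊓ t) + (k ∸ k ⊓ t) ≡ ∣ k - t ∣
[t∸k⊓t]+[k∸k⊓t]≡∣k-t∣ zero    t       = +-identityʳ t
[t∸k⊓t]+[k∸k⊓t]≡∣k-t∣ (suc k) zero    = refl
[t∸k⊓t]+[k∸k⊓t]≡∣k-t∣ (suc k) (suc t) = [t∸k⊓t]+[k∸k⊓t]≡∣k-t∣ k t

module SparsePavingCoefficients {n} (r : ℕ)
  {ℋ : Subset n → Set} (ℋ? : Decidable ℋ)
  (ℋ-size : ∀ {A} → ℋ A → ∣ A ∣ ≡ suc r)
  (ℋ-apart : ∀ {A B} → ℋ A → ℋ B → suc r ≤ suc ∣ A ∩ B ∣ → A ≡ B)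
  (r<n : suc r < n) where

  open SparsePaving r ℋ? ℋ-size ℋ-apart

  rank-⊤ : rank ⊤ ≡ suc r
  rank-⊤ with ℋ? ⊤
  ... | yes ⊤∈ℋ = contradiction (trans (sym (ℋ-size ⊤∈ℋ)) (∣⊤∣≡n n)) (<⇒≢ r<n)
  ... | no  _   = m≥n⇒m⊓n≡n (≤-trans (<⇒≤ r<n) (≤-reflexive (sym (∣⊤∣≡n n))))

  corank+nullity-ℋ : ∀ {A} → ℋ A → corank+nullity matroid A ≡ 2
  corank+nullity-ℋ {A} A∈ℋ rewrite rank-⊤ | dec-true (ℋ? A) A∈ℋ | ℋ-size A∈ℋ | m+n∸n≡m 1 r = refl

  corank+nullity-¬ℋ : ∀ {A} → ¬ ℋ A → corank+nullity matroid A ≡ ∣ ∣ A ∣ - suc r ∣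
  corank+nullity-¬ℋ {A} A∉ℋ rewrite rank-⊤ | dec-false (ℋ? A) A∉ℋ =
    [t∸k⊓t]+[k∸k⊓t]≡∣k-t∣ ∣ A ∣ (suc r)

  ∣ℋ∣ : ℕ
  ∣ℋ∣ = ∑ (λ A → 𝟙 (does (ℋ? A)))

  𝟙-corank+nullity : ∀ A j → 𝟙 (corank+nullity matroid A ≡ᵇ suc j)
    ≡ 𝟙 (∣ ∣ A ∣ - suc r ∣ ≡ᵇ suc j) + 𝟙 (does (ℋ? A)) * 𝟙 (2 ≡ᵇ suc j)
  -- A with-abstraction of ℋ? A would also rewrite its occurrence inside rank A.
  𝟙-corank+nullity A j = by-cases (ℋ? A)
    where
    open ≡-Reasoning
    rhs : ℕ → Bool → ℕ
    rhs d b = 𝟙 (d ≡ᵇ suc j) + 𝟙 b * 𝟙 (2 ≡ᵇ suc j)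
    by-cases : Dec (ℋ A) →
      𝟙 (corank+nullity matroid A ≡ᵇ suc j) ≡ rhs ∣ ∣ A ∣ - suc r ∣ (does (ℋ? A))
    by-cases (yes A∈ℋ) = begin
      𝟙 (corank+nullity matroid A ≡ᵇ suc j)
        ≡⟨ cong (λ d → 𝟙 (d ≡ᵇ suc j)) (corank+nullity-ℋ A∈ℋ) ⟩
      𝟙 (2 ≡ᵇ suc j)                         ≡⟨ +-identityʳ _ ⟨
      rhs 0 true
        ≡⟨ cong₂ rhs (m≡n⇒∣m-n∣≡0 (ℋ-size A∈ℋ)) (dec-true (ℋ? A) A∈ℋ) ⟨
      rhs ∣ ∣ A ∣ - suc r ∣ (does (ℋ? A))    ∎
    by-cases (no A∉ℋ) = begin
      𝟙 (corank+nullity matroid A ≡ᵇ suc j)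
        ≡⟨ cong (λ d → 𝟙 (d ≡ᵇ suc j)) (corank+nullity-¬ℋ A∉ℋ) ⟩
      𝟙 (∣ ∣ A ∣ - suc r ∣ ≡ᵇ suc j)         ≡⟨ +-identityʳ _ ⟨
      rhs ∣ ∣ A ∣ - suc r ∣ false
        ≡⟨ cong (rhs ∣ ∣ A ∣ - suc r ∣) (dec-false (ℋ? A) A∉ℋ) ⟨
      rhs ∣ ∣ A ∣ - suc r ∣ (does (ℋ? A))    ∎

  -- In the uniform matroid the members of `ℋ` sit at exponent 0, so at the positive exponent
  -- `suc j` their move is a pure gain, present only at exponent 2. The lower layer has size
  -- `suc r ∸ suc j`, that is `r ∸ j`.
  coeff-sparsePaving : ∀ {j} → j ≤ r → coeff (diagonalTutte matroid) (suc j)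
    ≡ ℤ.+ (n C (r ∸ j) + n C (suc r + suc j) + ∣ℋ∣ * 𝟙 (2 ≡ᵇ suc j))
  coeff-sparsePaving {j} j≤r = trans (coeff-diagonalTutte matroid (suc j)) (cong ℤ.+_ (begin
    ∑ (λ A → 𝟙 (corank+nullity matroid A ≡ᵇ suc j))  ≡⟨ ∑-cong (λ A → 𝟙-corank+nullity A j) ⟩
    ∑ (λ A → 𝟙 (∣ ∣ A ∣ - suc r ∣ ≡ᵇ suc j) + 𝟙 (does (ℋ? A)) * e)
      ≡⟨ ∑-+ (λ A → 𝟙 (∣ ∣ A ∣ - suc r ∣ ≡ᵇ suc j)) (λ A → 𝟙 (does (ℋ? A)) * e) ⟩
    ∑ {n} (λ A → 𝟙 (∣ ∣ A ∣ - suc r ∣ ≡ᵇ suc j)) + ∑ (λ A → 𝟙 (does (ℋ? A)) * e)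
      ≡⟨ cong₂ _+_ layers (∑-*ʳ (λ A → 𝟙 (does (ℋ? A))) e) ⟩
    n C s + n C (suc r + suc j) + ∣ℋ∣ * e ∎))
    where
    open ≡-Reasoning
    e = 𝟙 (2 ≡ᵇ suc j)
    s = r ∸ j
    s+j≡r : s + suc j ≡ suc r
    s+j≡r = trans (+-suc s j) (cong suc (m∸n+n≡m j≤r))
    layers : ∑ {n} (λ A → 𝟙 (∣ ∣ A ∣ - suc r ∣ ≡ᵇ suc j)) ≡ n C s + n C (suc r + suc j)
    layers = begin
      ∑ {n} (λ A → 𝟙 (∣ ∣ A ∣ - suc r ∣ ≡ᵇ suc j))
        ≡⟨ ∑-cong {n} (λ A → subst
             (λ t → 𝟙 (∣ ∣ A ∣ - t ∣ ≡ᵇ suc j) ≡ 𝟙 (∣ A ∣ ≡ᵇ s) + 𝟙 (∣ A ∣ ≡ᵇ t + suc j))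
             s+j≡r (𝟙-distance s j ∣ A ∣)) ⟩
      ∑ {n} (λ A → 𝟙 (∣ A ∣ ≡ᵇ s) + 𝟙 (∣ A ∣ ≡ᵇ suc r + suc j))
        ≡⟨ ∑-+ {n} (λ A → 𝟙 (∣ A ∣ ≡ᵇ s)) (λ A → 𝟙 (∣ A ∣ ≡ᵇ suc r + suc j)) ⟩
      ∑ {n} (λ A → 𝟙 (∣ A ∣ ≡ᵇ s)) + ∑ {n} (λ A → 𝟙 (∣ A ∣ ≡ᵇ suc r + suc j))
        ≡⟨ cong₂ _+_ (∑-size n s) (∑-size n (suc r + suc j)) ⟩
      n C s + n C (suc r + suc j) ∎

  corank+nullity≤ : suc r ≤ n ∸ suc r → 2 ≤ n ∸ suc r → ∀ A →
    corank+nullity matroid A ≤ n ∸ suc r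
  corank+nullity≤ r≤ 2≤ A = by-cases (ℋ? A)
    where
    bound : ∣ ∣ A ∣ - suc r ∣ ≤ n ∸ suc r
    bound with ≤-total ∣ A ∣ (suc r)
    ... | inj₁ a≤r = ≤-trans (≤-reflexive (m≤n⇒∣m-n∣≡n∸m a≤r)) (≤-trans (m∸n≤m (suc r) ∣ A ∣) r≤)
    ... | inj₂ r≤a = ≤-trans (≤-reflexive (m≤n⇒∣n-m∣≡n∸m r≤a)) (∸-monoˡ-≤ (suc r) (∣p∣≤n A))
    by-cases : Dec (ℋ A) → corank+nullity matroid A ≤ n ∸ suc r
    by-cases (yes A∈ℋ) = ≤-trans (≤-reflexive (corank+nullity-ℋ A∈ℋ)) 2≤
    by-cases (no  A∉ℋ) = ≤-trans (≤-reflexive (corank+nullity-¬ℋ A∉ℋ)) bound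

  corank+nullity-⊤ : corank+nullity matroid ⊤ ≡ n ∸ suc r
  corank+nullity-⊤ rewrite rank-⊤ | ∣⊤∣≡n n = cong (_+ (n ∸ suc r)) (n∸n≡0 r)

  -- The full set attains the exponent `n ∸ suc r`. The first hypothesis keeps small sets, down to
  -- the empty one, below it; the second does so for `ℋ`.
  hasDegree : suc r ≤ n ∸ suc r → 2 ≤ n ∸ suc r →
    HasDegree (diagonalTutte matroid) (n ∸ suc r)
  hasDegree r≤ 2≤ = leading , above
    where
    d = n ∸ suc r
    leading : coeff (diagonalTutte matroid) d ≢ ℤ.0ℤ
    leading coeff≡0 = <⇒≢ (begin-strict
      0  <⟨ z<s ⟩
      1  ≡⟨ cong 𝟙 (dec-true (corank+nullity matroid ⊤ ≟ d) corank+nullity-⊤) ⟨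
      𝟙 (corank+nullity matroid ⊤ ≡ᵇ d)
        ≤⟨ term≤∑ (λ A → 𝟙 (corank+nullity matroid A ≡ᵇ d)) ⊤ ⟩
      ∑ (λ A → 𝟙 (corank+nullity matroid A ≡ᵇ d)) ∎)
      (sym (ℤ.+-injective (trans (sym (coeff-diagonalTutte matroid d)) coeff≡0)))
      where open ≤-Reasoning
    above : ∀ i → d < i → coeff (diagonalTutte matroid) i ≡ ℤ.0ℤ
    above i d<i = trans (coeff-diagonalTutte matroid i) (cong ℤ.+_ (trans
      (∑-cong λ A → cong 𝟙 (dec-false (corank+nullity matroid A ≟ i)
        (<⇒≢ (≤-<-trans (corank+nullity≤ r≤ 2≤ A) d<i))))
      (∑-zero n)))

-- The Graham–Sloane code

-- The offset `k` is the index of the head, so positions keep their global numbers during recursion.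
indexSum : ∀ {n} → ℕ → Subset n → ℕ
indexSum k []            = 0
indexSum k (inside  ∷ A) = k + indexSum (suc k) A
indexSum k (outside ∷ A) = indexSum (suc k) A

private
  <-suc-shift : ∀ {k i n} → i < suc k + n → i < k + suc n
  <-suc-shift {k} {i} {n} = subst (i <_) (sym (+-suc k n))

-- The size conditions say that `B` is `A` with one new element `j`. The bound `k ≤ j` later
-- separates `j` from an index already passed.
indexSum-insert : ∀ {n} k (A B : Subset n) → ∣ A ∣ ≤ ∣ A ∩ B ∣ → ∣ B ∣ ≡ suc ∣ A ∣ →
  ∃[ j ] k ≤ j × j < k + n × indexSum k B ≡ j + indexSum k A
indexSum-insert k (outside ∷ A) (outside ∷ B) le eq =
  let j , k<j , j<k+n , e = indexSum-insert (suc k) A B le eq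
  in  j , <⇒≤ k<j , <-suc-shift j<k+n , e
indexSum-insert k (inside ∷ A) (outside ∷ B) le eq =
  contradiction (≤-trans le (∣p∩q∣≤∣p∣ A B)) (<-irrefl refl)
indexSum-insert {suc n} k (outside ∷ A) (inside ∷ B) le eq =
  k , ≤-refl , <-suc-shift (m≤m+n (suc k) n) ,
  cong (λ C → k + indexSum (suc k) C) (⊆-antisym
    (∣p∣≤∣p∩q∣⇒p⊆q B A (subst₂ _≤_ (sym (suc-injective eq)) (cong ∣_∣ (∩-comm A B)) le))
    (∣p∣≤∣p∩q∣⇒p⊆q A B le))
indexSum-insert k (inside ∷ A) (inside ∷ B) le eq =
  let j , k<j , j<k+n , e = indexSum-insert (suc k) A B (s≤s⁻¹ le) (suc-injective eq)
  in  j , <⇒≤ k<j , <-suc-shift j<k+n , trans (cong (k +_) e) (x∙yz≈y∙xz k j _)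

-- Such sets differ by one swap: `i` is the element only in `B` and `j` the element only in `A`. The
-- first position where they differ supplies one of the two, and what remains is an insertion.
indexSum-exchange : ∀ {n} k (A B : Subset n) → ∣ A ∣ ≡ ∣ B ∣ → ∣ A ∣ ≤ suc ∣ A ∩ B ∣ → A ≢ B →
  ∃₂ λ i j → i < k + n × j < k + n × i ≢ j × i + indexSum k A ≡ j + indexSum k B
indexSum-exchange k [] [] eq le A≢B = contradiction refl A≢B
indexSum-exchange k (outside ∷ A) (outside ∷ B) eq le A≢B =
  let i , j , i< , j< , i≢j , e = indexSum-exchange (suc k) A B eq le (A≢B ∘ cong (outside ∷_))
  in  i , j , <-suc-shift i< , <-suc-shift j< , i≢j , e
indexSum-exchange k (inside ∷ A) (inside ∷ B) eq le A≢B =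
  let i , j , i< , j< , i≢j , e =
        indexSum-exchange (suc k) A B (suc-injective eq) (s≤s⁻¹ le) (A≢B ∘ cong (inside ∷_))
  in  i , j , <-suc-shift i< , <-suc-shift j< , i≢j ,
      trans (x∙yz≈y∙xz i k _) (trans (cong (k +_) e) (x∙yz≈y∙xz k j _))
indexSum-exchange {suc n} k (inside ∷ A) (outside ∷ B) eq le A≢B =
  let j , k<j , j< , e = indexSum-insert (suc k) A B (s≤s⁻¹ le) (sym eq)
  in  j , k , <-suc-shift j< , <-suc-shift (m≤m+n (suc k) n) , <⇒≢ k<j ∘ sym ,
      trans (x∙yz≈y∙xz j k _) (cong (k +_) (sym e))
indexSum-exchange {suc n} k (outside ∷ A) (inside ∷ B) eq le A≢B =
  let j , k<j , j< , e = indexSum-insert (suc k) B A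
        (subst (∣ B ∣ ≤_) (cong ∣_∣ (∩-comm A B)) (s≤s⁻¹ (subst (_≤ suc ∣ A ∩ B ∣) eq le))) eq
  in  k , j , <-suc-shift (m≤m+n (suc k) n) , <-suc-shift j< , <⇒≢ k<j ,
      trans (cong (k +_) e) (x∙yz≈y∙xz k j _)

-- Cancelling the common remainder of `a` and `b` leaves `i` and `j` equal up to multiples of `n`,
-- and both are already reduced.
%-cancel : ∀ {i j a b} n .{{_ : NonZero n}} →
  i + a ≡ j + b → a % n ≡ b % n → i < n → j < n → i ≡ j
%-cancel {i} {j} {a} {b} n i+a≡j+b a≡b i<n j<n = begin
  i                              ≡⟨ m<n⇒m%n≡m i<n ⟨
  i % n                          ≡⟨ [m+kn]%n≡m%n i (a / n) n ⟨
  (i + a / n * n) % n            ≡⟨ cong (_% n) (+-cancelˡ-≡ (a % n) _ _ shifted) ⟩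
  (j + b / n * n) % n            ≡⟨ [m+kn]%n≡m%n j (b / n) n ⟩
  j % n                          ≡⟨ m<n⇒m%n≡m j<n ⟩
  j                              ∎
  where
  open ≡-Reasoning
  shifted : a % n + (i + a / n * n) ≡ a % n + (j + b / n * n)
  shifted = begin
    a % n + (i + a / n * n)  ≡⟨ x∙yz≈y∙xz (a % n) i _ ⟩
    i + (a % n + a / n * n)  ≡⟨ cong (_+_ i) (m≡m%n+[m/n]*n a n) ⟨
    i + a                    ≡⟨ i+a≡j+b ⟩
    j + b                    ≡⟨ cong (_+_ j) (m≡m%n+[m/n]*n b n) ⟩
    j + (b % n + b / n * n)  ≡⟨ x∙yz≈y∙xz j (b % n) _ ⟩
    b % n + (j + b / n * n)  ≡⟨ cong (_+ (j + b / n * n)) a≡b ⟨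
    a % n + (j + b / n * n)  ∎

module GrahamSloane (n r c : ℕ) .{{_ : NonZero n}} where

  ℋ : Subset n → Set
  ℋ A = ∣ A ∣ ≡ suc r × indexSum 0 A % n ≡ c

  ℋ? : Decidable ℋ
  ℋ? A = (∣ A ∣ ≟ suc r) ×-dec (indexSum 0 A % n ≟ c)

  -- Distinct members this close would differ by swapping two distinct indices below `n`, yet equal
  -- index sums modulo `n` force these indices to agree.
  ℋ-apart : ∀ {A B} → ℋ A → ℋ B → suc r ≤ suc ∣ A ∩ B ∣ → A ≡ B
  ℋ-apart {A} {B} (∣A∣≡r , A%n≡c) (∣B∣≡r , B%n≡c) r≤ =
    decidable-stable (Vec.≡-dec Bool._≟_ A B) λ A≢B →
      let i , j , i<n , j<n , i≢j , e =
            indexSum-exchange 0 A B (trans ∣A∣≡r (sym ∣B∣≡r))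
              (subst (_≤ suc ∣ A ∩ B ∣) (sym ∣A∣≡r) r≤) A≢B
      in  i≢j (%-cancel n e (trans A%n≡c (sym B%n≡c)) i<n j<n)

large-class : ∀ n r k .{{_ : NonZero n}} → n * k < n C suc r →
  ∃[ c ] k < ∑ (λ A → 𝟙 (does (GrahamSloane.ℋ? n r c A)))
large-class n r k nk<nCr =
  let c , k<class = pigeonhole label size n k (subst (n * k <_) total nk<nCr)
  in  c , subst (k <_) (∑-cong (𝟙-ℋ? c)) k<class
  where
  label size : Subset n → ℕ
  label A = indexSum 0 A % n
  size  A = 𝟙 (∣ A ∣ ≡ᵇ suc r)
  𝟙-ℋ? : ∀ c A → 𝟙 (label A ≡ᵇ c) * size A ≡ 𝟙 (does (GrahamSloane.ℋ? n r c A))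
  𝟙-ℋ? c A = trans (*-comm (𝟙 (label A ≡ᵇ c)) (size A))
                   (sym (𝟙-∧ (∣ A ∣ ≡ᵇ suc r) (label A ≡ᵇ c)))
  -- Every residue is below `n`, so the label test discards nothing.
  total : n C suc r ≡ ∑ (λ A → 𝟙 (label A <ᵇ n) * size A)
  total = trans (sym (∑-size n (suc r))) (∑-cong λ A → sym (trans
    (cong (λ b → 𝟙 b * size A) (dec-true (label A <? n) (m%n<n (indexSum 0 A) n)))
    (*-identityˡ (size A))))

-- The dip at exponent 3 and its consequences

HasDip : ℕ → (ℕ → ℤ) → Set
HasDip d a = 3 < d × ℤ.0ℤ ℤ.≤ a 3 × a 3 ℤ.< a 2 × a 3 ℤ.< a 4

-- Rank `4 + s` guarantees that the layers four below and four above the rank are covered by the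
-- coefficient formula. The class chosen by pigeonhole lifts exponent 2 above exponent 3, while
-- `U 3 < U 4` persists unchanged.
sparsePaving-dip : ∀ n s .{{_ : NonZero n}} → let
    r = 4 + s
    U = λ j → n C (r ∸ j) + n C (r + j)
  in r < n → r ≤ n ∸ r → n * (U 3 ∸ U 2) < n C r → U 3 < U 4 →
  ∃[ n ] Σ[ M ∈ Matroid n ] ∃[ d ]
    HasDegree (diagonalTutte M) d × HasDip d (coeff (diagonalTutte M))
sparsePaving-dip n s r<n r≤ sparse rise =
  n , matroid , n ∸ (4 + s) ,
  hasDegree r≤ (≤-trans (s≤s (s≤s z≤n)) r≤) ,
  ≤-trans (m≤m+n 4 s) r≤ ,
  subst (ℤ.0ℤ ℤ.≤_) (sym (coeff-sparsePaving 2≤r)) (ℤ.+≤+ z≤n) ,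
  subst₂ ℤ._<_ (sym (coeff-sparsePaving 2≤r)) (sym (coeff-sparsePaving 1≤r)) (ℤ.+<+ fall′) ,
  subst₂ ℤ._<_ (sym (coeff-sparsePaving 2≤r)) (sym (coeff-sparsePaving 3≤r)) (ℤ.+<+ rise′)
  where
  U : ℕ → ℕ
  U j = n C (4 + s ∸ j) + n C (4 + s + j)
  class = large-class n (3 + s) (U 3 ∸ U 2) sparse
  open GrahamSloane n (3 + s) (proj₁ class)
  open SparsePaving (3 + s) ℋ? proj₁ ℋ-apart using (matroid)
  open SparsePavingCoefficients (3 + s) ℋ? proj₁ ℋ-apart r<n
  1≤r : 1 ≤ 3 + s
  1≤r = s≤s z≤n
  2≤r : 2 ≤ 3 + s
  2≤r = s≤s (s≤s z≤n)
  3≤r : 3 ≤ 3 + s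
  3≤r = m≤m+n 3 s
  fall′ : U 3 + ∣ℋ∣ * 0 < U 2 + ∣ℋ∣ * 1
  fall′ = begin-strict
    U 3 + ∣ℋ∣ * 0      ≡⟨ cong (U 3 +_) (*-zeroʳ ∣ℋ∣) ⟩
    U 3 + 0            ≡⟨ +-identityʳ (U 3) ⟩
    -- With truncated subtraction this is only an inequality, valid whichever of `U 2` and `U 3` is
    -- larger.
    U 3                ≤⟨ m≤n+m∸n (U 3) (U 2) ⟩
    U 2 + (U 3 ∸ U 2)  <⟨ +-monoʳ-< (U 2) (proj₂ class) ⟩
    U 2 + ∣ℋ∣          ≡⟨ cong (U 2 +_) (*-identityʳ ∣ℋ∣) ⟨
    U 2 + ∣ℋ∣ * 1      ∎
    where open ≤-Reasoning
  rise′ : U 3 + ∣ℋ∣ * 0 < U 4 + ∣ℋ∣ * 0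
  rise′ = +-monoˡ-< (∣ℋ∣ * 0) rise

-- A peak at or before 3 forbids the rise from 3 to 4; a later peak forbids the fall from 2 to 3.
dip⇒¬unimodal : ∀ {d a} → HasDip d a → ¬ Unimodal d a
dip⇒¬unimodal (3<d , _ , a₃<a₂ , a₃<a₄) (m , _ , up , down) with m ≤? 3
... | yes m≤3 = ℤ.<⇒≱ a₃<a₄ (down 3 m≤3 3<d)
... | no  m≰3 = ℤ.<⇒≱ a₃<a₂ (up 2 (<-trans (n<1+n 2) (≰⇒> m≰3)))

-- Since `a 3` is nonnegative, `a 2` is positive, and the square of `a 3` is at most `a 2 * a 3`,
-- hence less than `a 2 * a 4`.
dip⇒¬logConcave : ∀ {d a} → HasDip d a → ¬ LogConcave d a
dip⇒¬logConcave {a = a} (3<d , 0≤a₃ , a₃<a₂ , a₃<a₄) logConcave =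
  ℤ.<⇒≱ (ℤ.≤-<-trans a₃*a₃≤a₂*a₃ a₂*a₃<a₂*a₄) (logConcave 2 3<d)
  where
  instance
    a₃-nonNegative : ℤ.NonNegative (a 3)
    a₃-nonNegative = ℤ.nonNegative 0≤a₃
    a₂-positive : ℤ.Positive (a 2)
    a₂-positive = ℤ.positive (ℤ.≤-<-trans 0≤a₃ a₃<a₂)
  a₃*a₃≤a₂*a₃ : a 3 ℤ.* a 3 ℤ.≤ a 2 ℤ.* a 3
  a₃*a₃≤a₂*a₃ = ℤ.*-monoʳ-≤-nonNeg (a 3) (ℤ.<⇒≤ a₃<a₂)
  a₂*a₃<a₂*a₄ : a 2 ℤ.* a 3 ℤ.< a 2 ℤ.* a 4
  a₂*a₃<a₂*a₄ = ℤ.*-monoˡ-<-pos (a 2) a₃<a₄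

corollary7p22 : (∃[ n ] Σ[ M ∈ Matroid n ] ∃[ d ]
    Polynomial.HasDegree ℤ-ring (diagonalTutte M) d
    × ¬ LogConcave d (Polynomial.coeff ℤ-ring (diagonalTutte M)))
    × (∃[ n ] Σ[ M ∈ Matroid n ] ∃[ d ]
    Polynomial.HasDegree ℤ-ring (diagonalTutte M) d
    × ¬ Unimodal d (Polynomial.coeff ℤ-ring (diagonalTutte M)))
corollary7p22 = conclude (sparsePaving-dip 176 77
    -- With `s` equal to 77 the rank is 81 and the degree 95. The four numerical hypotheses are
    -- settled by evaluating Boolean comparisons of explicit numbers, and one matroid serves both
    -- halves.
    (<ᵇ⇒< _ _ _) (≤ᵇ⇒≤ _ _ _) (<ᵇ⇒< _ _ _) (<ᵇ⇒< _ _ _))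
  where
  -- Matching here, on a variable, keeps the type checker from evaluating the
  -- matroid on 176 elements.
  conclude : (∃[ n ] Σ[ M ∈ Matroid n ] ∃[ d ]
      HasDegree (diagonalTutte M) d × HasDip d (coeff (diagonalTutte M))) → _
  conclude (n , M , d , degree , dip) =
    (n , M , d , degree , dip⇒¬logConcave {a = coeff (diagonalTutte M)} dip) ,
    (n , M , d , degree , dip⇒¬unimodal dip)
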